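{- Let $T$ be any (finite) tree with at least one edge. Then $r(T) = \Delta(T)$, where $r(T)$ is the regular number of $T$ and $\Delta(T)$ denotes the maximum degree of $T$.
   Context: All graphs are finite, simple and undirected. For a set $F$ of edges of a graph $G$, the subgraph induced by $F$, denoted $\langle F \rangle$, is the graph whose edge set is $F$ and whose vertex set is the set of endpoints of edges in $F$ (it need not contain all the vertices of $G$). The regular number $r(G)$ of a graph $G=(V,E)$ is the minimum number of nonempty subsets into which the edge set $E$ can be partitioned so that the subgraph induced by each subset is regular (i.e. all of its vertices have the same degree; different subsets may have different degrees of regularity, and the induced subgraphs need not be connected). -}

module Defs where

open import Data.Fin.Base using (Fin)
open import Data.Fin.Properties using (any?)
open import Data.List.Base using (List; _∷_; _∷ʳ_; length; map; filter; allFin)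
open import Data.List.Extrema.Nat using (max)
open import Data.List.Relation.Unary.Linked using (Linked)
open import Data.List.Relation.Unary.Unique.Propositional using (Unique)
open import Data.Nat.Base using (ℕ; _≤_)
open import Data.Nat.Properties using (≤-antisym)
open import Data.Product.Base using (∃; ∃₂; _×_; _,_)
open import Level using (Level; 0ℓ)
open import Relation.Binary.Construct.Closure.ReflexiveTransitive using (Star)
open import Relation.Binary.Core using (Rel; _⇒_)
import Relation.Binary.Definitions as B
open import Relation.Binary.PropositionalEquality.Core using (_≡_)
open import Relation.Nullary.Negation.Core using (¬_)
open import Relation.Unary using (Pred; Decidable)

private
  variable
    ℓ : Level
    n k : ℕ

-- A set of unordered pairs of distinct elements of Fin n: the edge {u , v}
-- belongs to the set when Adj u v (equivalently Adj v u) is inhabited.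
record EdgeSet (n : ℕ) : Set₁ where
  field
    Adj        : Rel (Fin n) 0ℓ
    adj?       : B.Decidable Adj
    adj-sym    : B.Symmetric Adj
    adj-irrefl : ∀ {v} → ¬ Adj v v

open EdgeSet public

Nonempty : EdgeSet n → Set
Nonempty F = ∃₂ λ u v → Adj F u v

-- The vertex set is a decidable subset of Fin n rather than all of it, so that the
-- subgraph induced by a set of edges is again a graph.
record Graph (n : ℕ) : Set₁ where
  field
    Vertex   : Pred (Fin n) 0ℓ
    vertex?  : Decidable Vertex
    edges    : EdgeSet n
    endpoint : ∀ {u v} → Adj edges u v → Vertex u

open Graph public

⟨_⟩ : EdgeSet n → Graph n
⟨ F ⟩ = record
  { Vertex   = λ v → ∃ λ u → Adj F v u
  ; vertex?  = λ v → any? (adj? F v)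
  ; edges    = F
  ; endpoint = λ {u} {v} uv → v , uv
  }

degree : Graph n → Fin n → ℕ
degree {n} G v = length (filter (adj? (edges G) v) (allFin n))

-- The default value 0 is attained only when all degrees are 0.
Δ : Graph n → ℕ
Δ {n} G = max 0 (map (degree G) (filter (vertex? G) (allFin n)))

Regular : Graph n → Set
Regular G = ∀ {u v} → Vertex G u → Vertex G v → degree G u ≡ degree G v

record IsConnected (G : Graph n) : Set where
  field
    inhabited : ∃ (Vertex G)
    joined    : ∀ {u v} → Vertex G u → Vertex G v → Star (Adj (edges G)) u v

-- The cycle v, w₁, …, wₘ, v, with m ≥ 2 and v, w₁, …, wₘ distinct.
record Cycle (G : Graph n) : Set where
  field
    base     : Fin n
    rest     : List (Fin n)
    long     : 2 ≤ length rest
    distinct : Unique (base ∷ rest)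
    closed   : Linked (Adj (edges G)) ((base ∷ rest) ∷ʳ base)

record IsTree (G : Graph n) : Set where
  field
    connected : IsConnected G
    acyclic   : ¬ Cycle G

record IsPartition (E : EdgeSet n) (P : Fin k → EdgeSet n) : Set where
  field
    nonempty : ∀ i → Nonempty (P i)
    within   : ∀ i → Adj (P i) ⇒ Adj E
    covers   : ∀ {u v} → Adj E u v → ∃ λ i → Adj (P i) u v
    disjoint : ∀ {i j u v} → Adj (P i) u v → Adj (P j) u v → i ≡ j

HasRegularPartition : Graph n → ℕ → Set₁
HasRegularPartition {n} G k =
  ∃ λ (P : Fin k → EdgeSet n) →
    IsPartition (edges G) P × (∀ i → Regular ⟨ P i ⟩)

IsMinimum : Pred ℕ ℓ → Pred ℕ ℓ
IsMinimum P m = P m × (∀ k → P k → m ≤ k)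

IsMinimum-unique : {P : Pred ℕ ℓ} {m m′ : ℕ} →
                   IsMinimum P m → IsMinimum P m′ → m ≡ m′
IsMinimum-unique (pm , m≤) (pm′ , m′≤) = ≤-antisym (m≤ _ pm′) (m′≤ _ pm)

-- r(G) = m, as a relation; m is determined by G, by IsMinimum-unique.
IsRegularNumber : Graph n → ℕ → Set₁
IsRegularNumber G = IsMinimum (HasRegularPartition G)

{-# OPTIONS --safe #-}

-- A forest with an edge has a leaf, for otherwise a path could be prolonged until it
-- closes up to a cycle.  Hence in a tree every regular class of edges is a matching,
-- and the edges at one vertex lie in distinct classes: at least Δ classes are needed.
-- Conversely the edges of a forest split into Δ matchings: remove a leaf, split the
-- rest, and give the removed edge a class not yet used at the neighbour of the leaf.
-- None of the Δ matchings is empty, since fewer than Δ matchings do not suffice.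
module Submission where

open import Defs
open import Data.Fin.Base using (Fin; zero; suc; toℕ; punchIn; punchOut)
open import Data.Fin.Properties
  using (_≟_; any?; all?; injective⇒≤; punchIn-punchOut)
open import Data.List.Base using (List; []; _∷_; _∷ʳ_; length; lookup; filter; take; allFin)
open import Data.List.Extrema.Nat using (max≤v⁺; xs≤max)
import Data.List.Membership.DecPropositional as DecMembership
open import Data.List.Membership.Propositional using (_∈_; _∉_)
open import Data.List.Membership.Propositional.Properties
  using (∈-lookup; ∈-allFin; ∈-filter⁺; ∈-filter⁻; ∈-map⁺)
open import Data.List.Membership.Setoid.Properties using (index-injective)
open import Data.List.Properties using (filter-notAll)
open import Data.List.Relation.Unary.All as All using (All)
open import Data.List.Relation.Unary.All.Properties using (map⁺; ¬Any⇒All¬)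
open import Data.List.Relation.Unary.AllPairs using ([]; _∷_)
open import Data.List.Relation.Unary.Any as Any using (here; there; index)
open import Data.List.Relation.Unary.Linked as Linked using (Linked; [-]; _∷_)
open import Data.List.Relation.Unary.Unique.Propositional using (Unique)
import Data.List.Relation.Unary.Unique.Propositional.Properties as Unique
open import Data.Nat.Base using (ℕ; zero; suc; _+_; _≤_; _<_; z≤n; s≤s)
open import Data.Nat.Properties
  using (≤-trans; ≤-antisym; ≤-reflexive; <⇒≱; 1+n≰n; +-suc; m≤m+n)
open import Data.Nat.Induction using (<-wellFounded)
open import Data.Product.Base using (∃; ∃₂; _×_; _,_; proj₁; proj₂)
open import Data.Sum.Base using (_⊎_; inj₁; inj₂)
open import Function.Base using (_∘_)
open import Function.Definitions using (Injective)
open import Induction.WellFounded using (Acc; acc)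
open import Level using (Level)
open import Relation.Binary.Core using (Rel; _⇒_)
open import Relation.Binary.PropositionalEquality
  using (_≡_; _≢_; refl; sym; trans; cong; subst; setoid)
open import Relation.Nullary
  using (¬_; Dec; yes; no; ¬?; _×-dec_; _⊎-dec_; _→-dec_; contradiction; decidable-stable)

private
  variable
    a r : Level
    A : Set a
    n k m : ℕ

-- Lists without repetition, and closing a path up.

lookup-injective : {xs : List A} → Unique xs → Injective _≡_ _≡_ (lookup xs)
lookup-injective (_  ∷ _)   {zero}  {zero}  _  = refl
lookup-injective (x∉ ∷ _)   {zero}  {suc j} eq = contradiction eq (All.lookup x∉ (∈-lookup j))
lookup-injective (x∉ ∷ _)   {suc i} {zero}  eq = contradiction (sym eq) (All.lookup x∉ (∈-lookup i))
lookup-injective (_  ∷ xs!) {suc i} {suc j} eq = cong suc (lookup-injective xs! eq)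

unique⇒length≤ : {xs : List (Fin n)} → Unique xs → length xs ≤ n
unique⇒length≤ xs! = injective⇒≤ (lookup-injective xs!)

-- The `take` cuts the path just after `x`, where the step to `z` is appended. With `z` equal to the
-- head `y` this turns a path into a closed walk.
linked-close : {R : Rel A r} {x y z : A} {ys : List A} →
               Linked R (y ∷ ys) → (x∈ys : x ∈ ys) → R x z →
               Linked R ((y ∷ take (suc (toℕ (index x∈ys))) ys) ∷ʳ z)
linked-close (yx ∷ _) (here refl) xz = yx ∷ xz ∷ [-]
linked-close (yw ∷ l) (there x∈)  xz = yw ∷ linked-close l x∈ xz

-- Degrees and the maximum degree.

module _ (F : EdgeSet n) (v : Fin n) where

  neighbours : List (Fin n)
  neighbours = filter (adj? F v) (allFin n)

  deg : ℕ
  deg = length neighbours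

  neighbour : Fin deg → Fin n
  neighbour = lookup neighbours

  neighbour-adj : ∀ i → Adj F v (neighbour i)
  neighbour-adj i = proj₂ (∈-filter⁻ (adj? F v) {xs = allFin n} (∈-lookup i))

  neighbour-injective : Injective _≡_ _≡_ neighbour
  neighbour-injective = lookup-injective (Unique.filter⁺ (adj? F v) (Unique.allFin⁺ n))

  -- Each `f i` has a position in the list of neighbours, and equal positions hold equal entries.
  injective⇒≤deg : {f : Fin m → Fin n} → Injective _≡_ _≡_ f →
                   (∀ i → Adj F v (f i)) → m ≤ deg
  injective⇒≤deg {f = f} f-inj vf =
    injective⇒≤ λ {i} {j} → f-inj ∘ index-injective (setoid _) (position i) (position j)
    where
    position : ∀ i → f i ∈ neighbours
    position i = ∈-filter⁺ (adj? F v) (∈-allFin (f i)) (vf i)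

deg-mono : {E F : EdgeSet n} → Adj F ⇒ Adj E → ∀ v → deg F v ≤ deg E v
deg-mono {E = E} {F} F⊆E v =
  injective⇒≤deg E v (neighbour-injective F v) (F⊆E ∘ neighbour-adj F v)

deg≤Δ : (G : Graph n) → ∀ v → deg (edges G) v ≤ Δ G
deg≤Δ {n} G v with vertex? G v
... | yes v∈G = All.lookup (xs≤max 0 _)
  (∈-map⁺ (degree G) (∈-filter⁺ (vertex? G) (∈-allFin v) v∈G))
... | no  v∉G = ≤-trans isolated z≤n
  where
  isolated : deg (edges G) v ≤ 0
  -- Any neighbour would make `v` a vertex of `G`, so the neighbours inject into `Fin 0`.
  isolated = injective⇒≤ {f = λ i → contradiction (endpoint G (neighbour-adj (edges G) v i)) v∉G}
    λ {i} → contradiction (endpoint G (neighbour-adj (edges G) v i)) v∉G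

Δ≤ : (G : Graph n) → (∀ v → deg (edges G) v ≤ k) → Δ G ≤ k
Δ≤ {n} G deg≤k = max≤v⁺ z≤n (map⁺ (All.universal deg≤k (filter (vertex? G) (allFin n))))

-- Leaves of acyclic edge sets.

cycle-mono : {G H : Graph n} → Adj (edges G) ⇒ Adj (edges H) → Cycle G → Cycle H
cycle-mono G⊆H C = record
  { base     = base
  ; rest     = rest
  ; long     = long
  ; distinct = distinct
  ; closed   = Linked.map G⊆H closed
  } where open Cycle C

-- `Cycle` takes a graph but reads only its edges, so `⟨ F ⟩` can stand for any graph with edge set
-- `F`.
Acyclic : EdgeSet n → Set
Acyclic F = ¬ Cycle ⟨ F ⟩

Leaf : EdgeSet n → Fin n → Fin n → Set
Leaf F v u = Adj F v u × (∀ w → Adj F v w → w ≡ u)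

IsMatching : EdgeSet n → Set
IsMatching F = ∀ {v u w} → Adj F v u → Adj F v w → u ≡ w

module _ (F : EdgeSet n) (branch : ∀ {v u} → Adj F v u → ∃ λ w → Adj F v w × w ≢ u) where

  open DecMembership (_≟_ {n}) using (_∈?_)

  -- The path grows at its head, and `m` is fuel: `m` plus the length stays constant and above `n`,
  -- so fuel cannot run out before a vertex repeats. A repeated vertex lies in `ws`, beyond `u`, so
  -- the cycle has at least three vertices.
  path⇒cycle : ∀ m {v u ws} → Unique (v ∷ u ∷ ws) → Linked (Adj F) (v ∷ u ∷ ws) →
               n < m + length (v ∷ u ∷ ws) → Cycle ⟨ F ⟩
  path⇒cycle zero    path! _    n< = contradiction (unique⇒length≤ path!) (<⇒≱ n<)
  path⇒cycle (suc m) {v} {u} {ws} path! path n< with branch (Linked.head path)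
  ... | x , vx , x≢u with x ∈? ws
  ...   | yes x∈ws = record
    { base     = v
    ; rest     = u ∷ take (suc (toℕ (index x∈ws))) ws
    ; long     = s≤s (take-nonempty x∈ws)
    ; distinct = Unique.take⁺ (3 + toℕ (index x∈ws)) path!
    ; closed   = linked-close path (there x∈ws) (adj-sym F vx)
    }
    where
    take-nonempty : ∀ {x k} {ys : List (Fin n)} → x ∈ ys → 1 ≤ length (take (suc k) ys)
    take-nonempty {ys = _ ∷ _} _ = s≤s z≤n
  ...   | no  x∉ws = path⇒cycle m (¬Any⇒All¬ _ x∉path ∷ path!) (adj-sym F vx ∷ path)
    (≤-trans n< (≤-reflexive (sym (+-suc m _))))
    where
    x∉path : x ∉ v ∷ u ∷ ws
    x∉path (here refl)         = adj-irrefl F vx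
    x∉path (there (here x≡u))  = x≢u x≡u
    x∉path (there (there x∈))  = x∉ws x∈

-- Having a leaf is decidable by search over `Fin n`, so it is enough to refute its absence.
acyclic⇒leaf : (F : EdgeSet n) → Acyclic F → Nonempty F → ∃₂ (Leaf F)
acyclic⇒leaf {n} F acyclic (v , u , vu) = decidable-stable leaf? λ noLeaf →
  acyclic (path⇒cycle F (branch noLeaf) (suc n)
    ((v≢u All.∷ All.[]) ∷ All.[] ∷ []) (vu ∷ [-]) (s≤s (m≤m+n n 2)))
  where
  v≢u : v ≢ u
  v≢u refl = adj-irrefl F vu

  leaf? : Dec (∃₂ (Leaf F))
  leaf? = any? λ v → any? λ u → adj? F v u ×-dec all? λ w → adj? F v w →-dec w ≟ u

  branch : ¬ ∃₂ (Leaf F) → ∀ {v u} → Adj F v u → ∃ λ w → Adj F v w × w ≢ u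
  branch noLeaf {v} {u} vu = decidable-stable
    (any? λ w → adj? F v w ×-dec ¬? (w ≟ u))
    λ none → noLeaf (v , u , vu , λ w vw →
      decidable-stable (w ≟ u) λ w≢u → none (w , vw , w≢u))

-- Regular edge sets, matchings and the lower bound.

all-neighbours≡⇒deg≤1 : (F : EdgeSet n) → ∀ v → (∀ {u w} → Adj F v u → Adj F v w → u ≡ w) →
                        deg F v ≤ 1
all-neighbours≡⇒deg≤1 F v same = injective⇒≤ {f = λ _ → zero {0}} λ {i} {j} _ →
  neighbour-injective F v (same (neighbour-adj F v i) (neighbour-adj F v j))

adj⇒1≤deg : (F : EdgeSet n) → ∀ {v u} → Adj F v u → 1 ≤ deg F v
adj⇒1≤deg F {v} {u} vu = injective⇒≤deg F v {f = only} only-injective λ _ → vu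
  where
  only : Fin 1 → Fin _
  only _ = u

  only-injective : Injective _≡_ _≡_ only
  only-injective {zero} {zero} _ = refl

deg≤1⇒neighbours≡ : (F : EdgeSet n) → ∀ {v u w} → deg F v ≤ 1 → Adj F v u → Adj F v w → u ≡ w
deg≤1⇒neighbours≡ F {v} {u} {w} deg≤1 vu vw = decidable-stable (u ≟ w) λ u≢w →
  1+n≰n (≤-trans (injective⇒≤deg F v {f = pair} (pair-injective u≢w) pair-adj) deg≤1)
  where
  pair : Fin 2 → Fin _
  pair zero       = u
  pair (suc zero) = w

  pair-injective : u ≢ w → Injective _≡_ _≡_ pair
  pair-injective u≢w {zero}     {zero}     _  = refl
  pair-injective u≢w {zero}     {suc zero} eq = contradiction eq u≢w
  pair-injective u≢w {suc zero} {zero}     eq = contradiction (sym eq) u≢w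
  pair-injective u≢w {suc zero} {suc zero} _  = refl

  pair-adj : ∀ i → Adj F v (pair i)
  pair-adj zero       = vu
  pair-adj (suc zero) = vw

-- Every vertex of `⟨ F ⟩` is an endpoint of an edge, so in a matching all degrees are exactly 1.
matching⇒regular : (F : EdgeSet n) → IsMatching F → Regular ⟨ F ⟩
matching⇒regular F matching {u} {v} u∈ v∈ = trans (deg≡1 u∈) (sym (deg≡1 v∈))
  where
  deg≡1 : ∀ {v} → Vertex ⟨ F ⟩ v → deg F v ≡ 1
  deg≡1 {v} (_ , vw) = ≤-antisym (all-neighbours≡⇒deg≤1 F v matching) (adj⇒1≤deg F vw)

-- A single leaf fixes the common degree at 1, in all components at once.
acyclic∧regular⇒matching : (F : EdgeSet n) → Acyclic F → Regular ⟨ F ⟩ → IsMatching F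
acyclic∧regular⇒matching F acyclic regular {v} {u} vu
  with acyclic⇒leaf F acyclic (v , u , vu)
... | l , p , lp , only-p = deg≤1⇒neighbours≡ F (≤-trans (≤-reflexive (regular (u , vu) (p , lp)))
  (all-neighbours≡⇒deg≤1 F l λ lx ly → trans (only-p _ lx) (sym (only-p _ ly)))) vu

-- Choosing a class for each edge at `v` is injective, since a matching has at most one edge at `v`.
-- This gives the lower bound and also the nonemptiness of the constructed classes.
matchings⇒Δ≤ : (G : Graph n) (P : Fin k → EdgeSet n) → (∀ i → IsMatching (P i)) →
               (∀ {u v} → Adj (edges G) u v → ∃ λ i → Adj (P i) u v) → Δ G ≤ k
matchings⇒Δ≤ {k = k} G P matching covers = Δ≤ G λ v → injective⇒≤ (class-injective v)
  where
  E = edges G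

  covered : ∀ v i → ∃ λ c → Adj (P c) v (neighbour E v i)
  covered v i = covers (neighbour-adj E v i)

  class-injective : ∀ v → Injective _≡_ _≡_ (proj₁ ∘ covered v)
  class-injective v {i} {j} eq = neighbour-injective E v (matching _
    (proj₂ (covered v i))
    (subst (λ c → Adj (P c) v (neighbour E v j)) (sym eq) (proj₂ (covered v j))))

-- Splitting a forest into matchings.

-- Unlike in IsPartition, the classes may be empty.
record Decomposition (E : EdgeSet n) (k : ℕ) : Set₁ where
  field
    class    : Fin k → EdgeSet n
    within   : ∀ i → Adj (class i) ⇒ Adj E
    covers   : ∀ {u v} → Adj E u v → ∃ λ i → Adj (class i) u v
    disjoint : ∀ {i j u v} → Adj (class i) u v → Adj (class j) u v → i ≡ j
    matching : ∀ i → IsMatching (class i)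

open Decomposition

edgeless : (E : EdgeSet n) → ¬ Nonempty E → Decomposition E k
edgeless E empty = record
  { class    = λ _ → E
  ; within   = λ _ uv → uv
  ; covers   = λ uv → contradiction (_ , _ , uv) empty
  ; disjoint = λ uv _ → contradiction (_ , _ , uv) empty
  ; matching = λ _ uv → contradiction (_ , _ , uv) empty
  }

infixl 6 _∖_

-- Only the edges at `v` go; the ambient `Fin n` stays, so the recursion on forests keeps `n` fixed.
_∖_ : EdgeSet n → Fin n → EdgeSet n
F ∖ v = record
  { Adj        = λ x y → Adj F x y × x ≢ v × y ≢ v
  ; adj?       = λ x y → adj? F x y ×-dec ¬? (x ≟ v) ×-dec ¬? (y ≟ v)
  ; adj-sym    = λ (xy , x≢v , y≢v) → adj-sym F xy , y≢v , x≢v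
  ; adj-irrefl = λ (vv , _) → adj-irrefl F vv
  }

edge : {u v : Fin n} → u ≢ v → EdgeSet n
edge {u = u} {v} u≢v = record
  { Adj        = λ x y → (x ≡ u × y ≡ v) ⊎ (x ≡ v × y ≡ u)
  ; adj?       = λ x y → (x ≟ u ×-dec y ≟ v) ⊎-dec (x ≟ v ×-dec y ≟ u)
  ; adj-sym    = λ where
      (inj₁ (x≡u , y≡v)) → inj₂ (y≡v , x≡u)
      (inj₂ (x≡v , y≡u)) → inj₁ (y≡u , x≡v)
  ; adj-irrefl = λ where
      (inj₁ (x≡u , x≡v)) → u≢v (trans (sym x≡u) x≡v)
      (inj₂ (x≡v , x≡u)) → u≢v (trans (sym x≡u) x≡v)
  }

module _ {E : EdgeSet n} {v u : Fin n} (leaf : Leaf E v u) (D : Decomposition (E ∖ v) k) where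

  Free : Fin k → Set
  Free i = ¬ ∃ λ w → Adj (class D i) u w

  private
    vu : Adj E v u
    vu = proj₁ leaf

    v≢u : v ≢ u
    v≢u refl = adj-irrefl E vu

  -- Otherwise v together with one neighbour from each class makes 1 + k neighbours of u.
  free : deg E u ≤ k → ∃ Free
  free deg≤k = decidable-stable (any? λ i → ¬? (any? (adj? (class D i) u))) λ noneFree →
    1+n≰n (≤-trans (k<deg λ i → decidable-stable (any? (adj? (class D i) u)) λ unused →
      noneFree (i , unused)) deg≤k)
    where
    module _ (used : ∀ i → ∃ λ w → Adj (class D i) u w) where

      old : ∀ i → Adj (E ∖ v) u (proj₁ (used i))
      old i = within D i (proj₂ (used i))

      star : Fin (suc k) → Fin n
      star zero    = v
      star (suc i) = proj₁ (used i)

      star-injective : Injective _≡_ _≡_ star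
      star-injective {zero}  {zero}  _  = refl
      star-injective {zero}  {suc j} eq = contradiction (sym eq) (proj₂ (proj₂ (old j)))
      star-injective {suc i} {zero}  eq = contradiction eq (proj₂ (proj₂ (old i)))
      star-injective {suc i} {suc j} eq = cong suc (disjoint D
        (subst (Adj (class D i) u) eq (proj₂ (used i))) (proj₂ (used j)))

      star-adj : ∀ i → Adj E u (star i)
      star-adj zero    = adj-sym E vu
      star-adj (suc i) = proj₁ (old i)

      k<deg : k < deg E u
      k<deg = injective⇒≤deg E u star-injective star-adj

  -- The edge `vu` joins a class `c` free at `u`; at `v` no conflict can arise, as `E ∖ v` has no
  -- edge there.
  extend : deg E u ≤ k → Decomposition E k
  extend deg≤k with free deg≤k
  ... | c , c-free = record
    { class    = class′
    ; within   = within′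
    ; covers   = covers′
    ; disjoint = disjoint′
    ; matching = matching′
    }
    where
    pendant : EdgeSet n
    pendant = edge v≢u

    class′ : Fin k → EdgeSet n
    class′ i = record
      { Adj        = λ x y → Adj (class D i) x y ⊎ (i ≡ c × Adj pendant x y)
      ; adj?       = λ x y → adj? (class D i) x y ⊎-dec (i ≟ c ×-dec adj? pendant x y)
      ; adj-sym    = λ where
          (inj₁ xy)        → inj₁ (adj-sym (class D i) xy)
          (inj₂ (eq , xy)) → inj₂ (eq , adj-sym pendant xy)
      ; adj-irrefl = λ where
          (inj₁ xx)       → adj-irrefl (class D i) xx
          (inj₂ (_ , xx)) → adj-irrefl pendant xx
      }

    within′ : ∀ i → Adj (class′ i) ⇒ Adj E
    within′ i (inj₁ xy)                       = proj₁ (within D i xy)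
    within′ i (inj₂ (_ , inj₁ (refl , refl))) = vu
    within′ i (inj₂ (_ , inj₂ (refl , refl))) = adj-sym E vu

    covers′ : ∀ {x y} → Adj E x y → ∃ λ i → Adj (class′ i) x y
    covers′ {x} {y} xy with x ≟ v | y ≟ v
    -- An edge at the leaf `v` can only be the pendant one.
    ... | yes refl | _        = c , inj₂ (refl , inj₁ (refl , proj₂ leaf y xy))
    ... | no _     | yes refl = c , inj₂ (refl , inj₂ (proj₂ leaf x (adj-sym E xy) , refl))
    ... | no x≢v   | no y≢v   with covers D (xy , x≢v , y≢v)
    ...   | i , xy′ = i , inj₁ xy′

    old∩pendant : ∀ {i x y} → Adj (class D i) x y → ¬ Adj pendant x y
    old∩pendant xy (inj₁ (x≡v , _)) = proj₁ (proj₂ (within D _ xy)) x≡v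
    old∩pendant xy (inj₂ (_ , y≡v)) = proj₂ (proj₂ (within D _ xy)) y≡v

    disjoint′ : ∀ {i j x y} → Adj (class′ i) x y → Adj (class′ j) x y → i ≡ j
    disjoint′ (inj₁ xy)         (inj₁ xy′)       = disjoint D xy xy′
    disjoint′ (inj₁ xy)         (inj₂ (_ , xy′)) = contradiction xy′ (old∩pendant xy)
    disjoint′ (inj₂ (_ , xy))   (inj₁ xy′)       = contradiction xy (old∩pendant xy′)
    disjoint′ (inj₂ (i≡c , _))  (inj₂ (j≡c , _)) = trans i≡c (sym j≡c)

    -- An endpoint `x` of the pendant edge is `v`, which no old edge meets, or `u`, where class `c`
    -- is free.
    old-avoids-pendant : ∀ {i x y z} → i ≡ c → Adj (class D i) x y → ¬ Adj pendant x z
    old-avoids-pendant _    xy (inj₁ (x≡v , _))  = proj₁ (proj₂ (within D _ xy)) x≡v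
    old-avoids-pendant refl xy (inj₂ (refl , _)) = c-free (_ , xy)

    matching′ : ∀ i → IsMatching (class′ i)
    matching′ i (inj₁ xy)        (inj₁ xz)        = matching D i xy xz
    matching′ i (inj₁ xy)        (inj₂ (eq , xz)) = contradiction xz (old-avoids-pendant eq xy)
    matching′ i (inj₂ (eq , xy)) (inj₁ xz)        = contradiction xy (old-avoids-pendant eq xz)
    matching′ i (inj₂ (_ , inj₁ (_ , refl))) (inj₂ (_ , inj₁ (_ , refl))) = refl
    matching′ i (inj₂ (_ , inj₂ (_ , refl))) (inj₂ (_ , inj₂ (_ , refl))) = refl
    -- Opposite orientations from a common start would identify `v` with `u`.
    matching′ i (inj₂ (_ , inj₁ (refl , _))) (inj₂ (_ , inj₂ (v≡u , _)))  =
      contradiction v≡u v≢u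
    matching′ i (inj₂ (_ , inj₂ (refl , _))) (inj₂ (_ , inj₁ (u≡v , _)))  =
      contradiction (sym u≡v) v≢u

-- The list contains all non-isolated vertices and shrinks as leaves are removed.
decompose : (E : EdgeSet n) → Acyclic E → (∀ v → deg E v ≤ k) →
            ∀ vs → (∀ {v u} → Adj E v u → v ∈ vs) → Acc _<_ (length vs) → Decomposition E k
decompose E acyclic deg≤k vs E⊆vs (acc rec) with any? (λ v → any? (adj? E v))
... | no  empty    = edgeless E empty
... | yes nonempty with acyclic⇒leaf E acyclic nonempty
...   | v , u , leaf@(vu , _) = extend {E = E} leaf rest (deg≤k u)
  where
  ≢v? = λ x → ¬? (x ≟ v)

  rest = decompose (E ∖ v) (acyclic ∘ cycle-mono proj₁)
    (λ w → ≤-trans (deg-mono {E = E} {E ∖ v} proj₁ w) (deg≤k w))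
    (filter ≢v? vs)
    (λ (xy , x≢v , _) → ∈-filter⁺ ≢v? (E⊆vs xy) x≢v)
    -- The edge `vu` puts `v` in `vs`, and `v` fails the test, so the filtered list is strictly
    -- shorter.
    (rec (filter-notAll ≢v? vs (Any.map (λ v≡x x≢v → x≢v (sym v≡x)) (E⊆vs vu))))

-- The regular number of a tree.

-- Were class `i` empty, the others, enumerated by `punchIn i`, would cover all edges with one
-- matching fewer than `Δ G` allows.
Δ-classes-nonempty : (G : Graph n) (D : Decomposition (edges G) k) → k ≤ Δ G →
                     ∀ i → Nonempty (class D i)
Δ-classes-nonempty {k = suc k} G D k≤Δ i = decidable-stable
  (any? λ u → any? (adj? (class D i) u))
  λ empty → 1+n≰n (≤-trans k≤Δ (matchings⇒Δ≤ G (class D ∘ punchIn i)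
    (λ j → matching D (punchIn i j)) (others empty)))
  where
  others : ¬ Nonempty (class D i) → ∀ {u v} → Adj (edges G) u v →
           ∃ λ j → Adj (class D (punchIn i j)) u v
  others empty {u} {v} uv with covers D uv
  ... | j , uv′ = punchOut i≢j , subst (λ j → Adj (class D j) u v) (sym (punchIn-punchOut i≢j)) uv′
    where
    i≢j : i ≢ j
    i≢j refl = empty (u , v , uv′)

proposition2 : ∀ (n : ℕ) (T : Graph n) → IsTree T → Nonempty (edges T) → IsRegularNumber T (Δ T)
proposition2 n T tree _ = (class D , partition , λ i → matching⇒regular (class D i) (matching D i)) ,
  -- Minimality: the classes of any regular partition lie within `T`, so they are acyclic and hence
  -- matchings.
  λ k (P , isPartition , regular) → matchings⇒Δ≤ T P
    (λ i → acyclic∧regular⇒matching (P i)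
      (acyclic ∘ cycle-mono (IsPartition.within isPartition i)) (regular i))
    (IsPartition.covers isPartition)
  where
  acyclic : ¬ Cycle T
  acyclic = IsTree.acyclic tree

  D : Decomposition (edges T) (Δ T)
  D = decompose (edges T) (acyclic ∘ cycle-mono λ uv → uv) (deg≤Δ T)
    (allFin n) (λ _ → ∈-allFin _) (<-wellFounded _)

  partition : IsPartition (edges T) (class D)
  partition = record
    { nonempty = Δ-classes-nonempty T D (≤-reflexive refl)
    ; within   = within D
    ; covers   = covers D
    ; disjoint = disjoint D
    }
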